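{- Let $G=(V,E)$ be a control flow graph and $p,a,b\in V$ three distinct nodes such that $p$ is a predicate node with successors $s_1$ and $s_2$. Then $a,b$ are DOD on $p$ if and only if (i) $p$ has at least two successors in $A_p$, (ii) there exists an $s_1$-strip in $A_p$ that contains $a$ before $b$, and (iii) there exists an $s_2$-strip in $A_p$ that contains $b$ before $a$.
   Context: A control flow graph (CFG) is a finite directed graph $G=(V,E)$ in which every node has at most two outgoing edges; nodes with exactly two outgoing edges are predicate nodes. A path from $n_1$ is a nonempty finite or infinite sequence of nodes with each adjacent pair an edge; it is maximal if it is infinite or its last node has no successor. $V_p$ is the set of nodes occurring on all maximal paths from $p$ in $G$. For $V'\subseteq V$, a $V'$-interval from $x$ to $y$ is a finite path $n_1\ldots n_k$ in $G$ with $k\ge 2$, $n_1=x\in V'$, $n_k=y\in V'$, and $n_i\notin V'$ for $1<i<k$. $A_p$ is the directed graph with node set $V_p$ and an edge $(x,y)$ iff there is a $V_p$-interval from $x$ to $y$ in $G$. For $i\in\{1,2\}$, $V_i$ is the set of nodes $n\in V_p$ such that there is a finite path in $G$ from $s_i$ to $n$ whose nodes other than the last one all lie outside $V_p$ (possibly $n=s_i$). An $s_i$-strip is a finite path $n\ldots m$ in $A_p$ whose first node lies in $V_i$ and all of whose other nodes lie in $V_p\setminus V_i$, such that the successor of $m$ in $A_p$ is a node in $V_i$. For three distinct nodes $p,a,b$ with $p$ a predicate node with successors $s_1,s_2$, the nodes $a,b$ are DOD on $p$ if all maximal paths from $p$ contain both $a$ and $b$, all maximal paths from $s_1$ contain $a$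 before any occurrence of $b$, and all maximal paths from $s_2$ contain $b$ before any occurrence of $a$. -}

module Defs where

open import Data.Fin.Base using (Fin)
open import Data.Fin.Subset using (Subset; ∣_∣) renaming (_∈_ to _∈ₛ_)
open import Data.List.Base using (List; _∷_; _∷ʳ_; head; last; drop)
open import Data.List.Relation.Unary.All using (All)
open import Data.List.Relation.Unary.Linked using (Linked)
open import Data.Maybe.Base using (Maybe; just)
open import Data.Nat.Base using (ℕ; suc; _≤_; _<_)
open import Data.Product.Base using (∃-syntax; _×_)
open import Data.Unit.Base using (⊤)
open import Level using (0ℓ)
open import Relation.Binary.Core using (Rel)
open import Relation.Binary.PropositionalEquality.Core using (_≡_; _≢_)
open import Relation.Nullary.Negation.Core using (¬_)
open import Relation.Unary using (Pred; ∁; _∈_; _∖_)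

-- Nodes are numbered; the edge relation is a subset of Node × Node (no
-- parallel edges), given by the set of successors of each node.
record CFG : Set where
  field
    size       : ℕ
    successors : Fin size → Subset size
    outdegree  : ∀ n → ∣ successors n ∣ ≤ 2

module _ {A : Set} where

  -- Position i of a list, counted from 0.
  nodeAt : List A → ℕ → Maybe A
  nodeAt xs i = head (drop i xs)

  -- Some occurrence of a precedes some occurrence of b.
  _Contains_Before_ : List A → A → A → Set
  xs Contains a Before b =
    ∃[ i ] ∃[ j ] (nodeAt xs i ≡ just a × nodeAt xs j ≡ just b × i < j)

module Graph (G : CFG) where
  open CFG G

  Node : Set
  Node = Fin size

  _⟶_ : Rel Node 0ℓ
  x ⟶ y = y ∈ₛ successors x

  -- An edge set has no repetitions, so the two successors are distinct.
  record IsPredicateWithSuccessors (p s₁ s₂ : Node) : Set where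
    field
      twoEdges : ∣ successors p ∣ ≡ 2
      edge₁    : p ⟶ s₁
      edge₂    : p ⟶ s₂
      distinct : s₁ ≢ s₂

  data Path : Set where
    finite   : ∀ x xs → Linked _⟶_ (x ∷ xs) → Path
    infinite : (f : ℕ → Node) → (∀ i → f i ⟶ f (suc i)) → Path

  _[_]=_ : Path → ℕ → Node → Set
  finite x xs _ [ i ]= n = nodeAt (x ∷ xs) i ≡ just n
  infinite f _  [ i ]= n = f i ≡ n

  Maximal : Pred Path 0ℓ
  Maximal (finite x xs _) = ∀ m → last (x ∷ xs) ≡ just m → ∀ y → ¬ (m ⟶ y)
  Maximal (infinite _ _)  = ⊤

  AllMaximalPathsFrom : Node → Pred Path 0ℓ → Set
  AllMaximalPathsFrom x P = ∀ π → π [ 0 ]= x → Maximal π → P π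

  Contains : Node → Pred Path 0ℓ
  Contains n π = ∃[ i ] (π [ i ]= n)

  ContainsBeforeAny : Node → Node → Pred Path 0ℓ
  ContainsBeforeAny a b π =
    ∃[ i ] (π [ i ]= a × (∀ j → π [ j ]= b → i < j))

  V[_] : Node → Pred Node 0ℓ
  V[ p ] n = AllMaximalPathsFrom p (Contains n)

  -- The list ms holds the interior nodes, so the path x ∷ (ms ∷ʳ y) has
  -- at least two nodes; x ≡ y is allowed.
  Interval : Pred Node 0ℓ → Rel Node 0ℓ
  Interval V′ x y = x ∈ V′ × y ∈ V′ ×
    ∃[ ms ] (All (_∈ ∁ V′) ms × Linked _⟶_ (x ∷ (ms ∷ʳ y)))

  -- Edges of the graph A_p; both endpoints of an edge lie in its node set V[ p ].
  A[_] : Node → Rel Node 0ℓ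
  A[ p ] = Interval V[ p ]

  -- V_i is Entry p s_i.
  Entry : Node → Node → Pred Node 0ℓ
  Entry p s n = n ∈ V[ p ] ×
    ∃[ ms ] (All (_∈ ∁ V[ p ]) ms
             × head (ms ∷ʳ n) ≡ just s
             × Linked _⟶_ (ms ∷ʳ n))

  -- "The successor of m" is read as a definite description: m has exactly
  -- one successor in A_p, and that successor lies in V_i.
  record IsStrip (p s : Node) (n : Node) (ns : List Node) : Set where
    field
      path      : Linked A[ p ] (n ∷ ns)
      first     : n ∈ Entry p s
      others    : All (_∈ V[ p ] ∖ Entry p s) ns
      m m′      : Node
      isLast    : last (n ∷ ns) ≡ just m
      successor : A[ p ] m m′
      unique    : ∀ y → A[ p ] m y → y ≡ m′
      returns   : m′ ∈ Entry p s

  StripContainingBefore : (p s a b : Node) → Set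
  StripContainingBefore p s a b =
    ∃[ n ] ∃[ ns ] (IsStrip p s n ns × (n ∷ ns) Contains a Before b)

  -- Order dependence of a, b on p, where s₁ is the successor forcing a first.
  record DOD (p s₁ s₂ a b : Node) : Set where
    field
      containsA : AllMaximalPathsFrom p (Contains a)
      containsB : AllMaximalPathsFrom p (Contains b)
      fromS₁    : AllMaximalPathsFrom s₁ (ContainsBeforeAny a b)
      fromS₂    : AllMaximalPathsFrom s₂ (ContainsBeforeAny b a)

{-# OPTIONS --safe #-}

-- If p has two successors in A_p, then V_p without p is a simple cycle of A_p that
-- is never left: a set of nodes in which one can walk on forever, or up to a dead
-- end, yields a maximal path from p, hence it must contain all of V_p. Both
-- directions are then read off this cycle. A strip pins down the nodes that precede
-- b on it back to a, and no entry from s₁ lies among them after a. Conversely, the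
-- s₁-strip is cut out of the cycle between the last entry before a and the first
-- entry after b; an entry between a and b would meet b before a.
--
-- Everything is constructive since the inductive predicates on nodes are decidable
-- as least fixed points over a finite set.
module Submission where

open import Defs
open import Data.Empty using (⊥-elim)
open import Data.Fin.Base using (Fin)
open import Data.Fin.Properties using (_≟_; any?; all?)
open import Data.Fin.Subset as Subset using (⁅_⁆; _⊃_) renaming (_∈_ to _∈ₛ_)
open import Data.Fin.Subset.Induction using (Acc; acc; ⊃-wellFounded)
open import Data.Fin.Subset.Properties
  using (_∈?_; ∉⊥; x∈p∪q⁻; p⊆p∪q; q⊆p∪q; x∈⁅x⁆; x∈⁅y⁆⇒x≡y)
open import Data.List.Base using (List; []; _∷_; _∷ʳ_; head; last)
open import Data.List.Relation.Unary.All as All using (All; []; _∷_)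
open import Data.List.Relation.Unary.Linked using (Linked; []; [-]; _∷_)
open import Data.Maybe.Base using (just)
open import Data.Maybe.Properties using (just-injective)
open import Data.Nat.Base using (ℕ; zero; suc; _+_; _<_; z≤n; s≤s; s≤s⁻¹; s<s⁻¹)
open import Data.Nat.Properties using (+-monoʳ-<; ≤-trans; m≤m+n; m≤n⇒m<n∨m≡n)
open import Data.Product.Base using (∃; ∃-syntax; _×_; _,_; proj₁; proj₂; map₂)
open import Data.Sum.Base as Sum using (_⊎_; inj₁; inj₂; [_,_]′)
open import Function.Base using (_∘_; id)
open import Function.Bundles using (_⇔_; mk⇔)
open import Level using (0ℓ)
open import Relation.Binary.Core using (Rel)
import Relation.Binary.Definitions as B
open import Relation.Binary.PropositionalEquality using (_≡_; _≢_; refl; sym; trans; cong; subst; ≢-sym)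
open import Relation.Nullary.Decidable
  using (Dec; yes; no; map′; ¬?; _×-dec_; _⊎-dec_; _→-dec_; decidable-stable)
open import Relation.Nullary.Negation using (¬_; contradiction)
open import Relation.Unary using (Pred; Decidable; ∁; ∅; U; _⊆_; _∪_; _∩_; _∖_)
open import Relation.Unary.Properties using (∁?; _∩?_; ∅?; U?)

-- Decidability of inductive predicates on a finite set.

-- Starting from the empty set, add elements of Φ Q to Q until Q is closed under Φ.
fixpoint? : ∀ {n} (Φ : Pred (Fin n) 0ℓ → Pred (Fin n) 0ℓ) →
  (∀ {Q R} → Q ⊆ R → Φ Q ⊆ Φ R) →
  (∀ {Q} → Decidable Q → Decidable (Φ Q)) →
  ∀ {P} → Φ P ⊆ P → (∀ {Q} → Φ Q ⊆ Q → P ⊆ Q) → Decidable P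
fixpoint? {n} Φ mono Φ? {P} intro elim =
  grow Subset.⊥ (⊃-wellFounded _) (⊥-elim ∘ ∉⊥)
  where
  grow : ∀ s → Acc _⊃_ s → (_∈ₛ s) ⊆ P → Decidable P
  grow s (acc rec) s⊆P with any? (λ x → Φ? (_∈? s) x ×-dec ¬? (x ∈? s))
  ... | yes (x , φ , x∉s) =
    grow (s Subset.∪ ⁅ x ⁆)
         (rec (p⊆p∪q ⁅ x ⁆ , x , q⊆p∪q s _ (x∈⁅x⁆ x) , x∉s))
         (λ y∈ → [ s⊆P , (λ y∈x → subst P (sym (x∈⁅y⁆⇒x≡y _ y∈x)) (intro (mono s⊆P φ))) ]′
                 (x∈p∪q⁻ s _ y∈))
  ... | no closed = λ x → map′ s⊆P
    (elim λ φ → decidable-stable (_ ∈? s) (λ y∉s → closed (_ , φ , y∉s)))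
    (x ∈? s)

module _ {n : ℕ} (_~>_ : Rel (Fin n) 0ℓ) where

  data Reach (S T : Pred (Fin n) 0ℓ) : Pred (Fin n) 0ℓ where
    stop : ∀ {x} → T x → Reach S T x
    step : ∀ {x y} → S x → x ~> y → Reach S T y → Reach S T x

  -- Inductive form of "every maximal path meets `c`, with no node of `D` earlier". The successor
  -- demanded by `step` excludes dead ends, where the universal premise would hold vacuously.
  data Until (D : Pred (Fin n) 0ℓ) (c : Fin n) : Pred (Fin n) 0ℓ where
    here : Until D c c
    step : ∀ {x} → ¬ D x → ∃ (x ~>_) → (∀ {y} → x ~> y → Until D c y) → Until D c x

module _ {n : ℕ} {_~>_ : Rel (Fin n) 0ℓ} (_~>?_ : B.Decidable _~>_) where

  reach? : ∀ {S T} → Decidable S → Decidable T → Decidable (Reach _~>_ S T)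
  reach? {S} {T} S? T? = fixpoint?
    (λ Q x → T x ⊎ (S x × ∃[ y ] (x ~> y × Q y)))
    (λ Q⊆R → λ { (inj₁ t) → inj₁ t
               ; (inj₂ (s , y , e , q)) → inj₂ (s , y , e , Q⊆R q) })
    (λ Q? x → T? x ⊎-dec (S? x ×-dec any? (λ y → (x ~>? y) ×-dec Q? y)))
    (λ { (inj₁ t) → stop t ; (inj₂ (s , _ , e , r)) → step s e r })
    elim
    where
    elim : ∀ {Q : Pred (Fin n) 0ℓ} → (∀ {x} → T x ⊎ (S x × ∃[ y ] (x ~> y × Q y)) → Q x) →
           Reach _~>_ S T ⊆ Q
    elim φ (stop t)     = φ (inj₁ t)
    elim φ (step s e r) = φ (inj₂ (s , _ , e , elim φ r))

  until? : ∀ {D} → Decidable D → ∀ c → Decidable (Until _~>_ D c)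
  until? {D} D? c = fixpoint? Φ
    (λ Q⊆R → λ { (inj₁ eq) → inj₁ eq
               ; (inj₂ (d , e , f)) → inj₂ (d , e , λ y x~>y → Q⊆R (f y x~>y)) })
    (λ Q? x → (x ≟ c) ⊎-dec (¬? (D? x) ×-dec any? (x ~>?_)
                ×-dec all? (λ y → (x ~>? y) →-dec Q? y)))
    (λ { (inj₁ refl) → here ; (inj₂ (d , e , f)) → step d e (f _) })
    elim
    where
    Φ : Pred (Fin n) 0ℓ → Pred (Fin n) 0ℓ
    Φ Q x = x ≡ c ⊎ (¬ D x × ∃ (x ~>_) × (∀ y → x ~> y → Q y))
    elim : ∀ {Q : Pred (Fin n) 0ℓ} → Φ Q ⊆ Q → Until _~>_ D c ⊆ Q
    elim φ here         = φ (inj₁ refl)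
    elim φ (step d e f) = φ (inj₂ (d , e , λ _ x~>y → elim φ (f x~>y)))

-- Maximal paths and their inductive characterisation.

module _ (G : CFG) where
  open CFG G
  open Graph G

  _⟶?_ : B.Decidable _⟶_
  x ⟶? y = y ∈? successors x

  Sink : Pred Node 0ℓ
  Sink x = ∀ y → ¬ (x ⟶ y)

  sink? : Decidable Sink
  sink? x = all? (λ y → ¬? (x ⟶? y))

  sinkOrSuccessor : ∀ x → Sink x ⊎ ∃ (x ⟶_)
  sinkOrSuccessor x with any? (x ⟶?_)
  ... | yes next = inj₂ next
  ... | no end   = inj₁ λ y e → end (y , e)

  -- ContainsBeforeAny with a set in place of the second node.
  Precedes : Pred Node 0ℓ → Node → Pred Path 0ℓ
  Precedes D c π = ∃[ i ] (π [ i ]= c × (∀ j {n} → π [ j ]= n → D n → i < j))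

  -- Compares positions only, which treats finite and infinite paths alike.
  record _IsTailOf_ (π′ π : Path) : Set where
    field
      down    : ∀ j {n} → π [ suc j ]= n → π′ [ j ]= n
      up      : ∀ j {n} → π′ [ j ]= n → π [ suc j ]= n

  [0]-unique : ∀ π {x y} → π [ 0 ]= x → π [ 0 ]= y → x ≡ y
  [0]-unique (finite _ _ _) refl refl = refl
  [0]-unique (infinite _ _) refl refl = refl

  uncons : ∀ π {x} → π [ 0 ]= x → Maximal π → ∃ (x ⟶_) →
           ∃[ y ] ∃[ π′ ] (x ⟶ y × π′ [ 0 ]= y × Maximal π′ × π′ IsTailOf π)
  uncons (finite x [] l) refl max (y , e) = contradiction e (max x refl y)
  uncons (finite x (y ∷ ys) (e ∷ l)) refl max _ =
    y , finite y ys l , e , refl , max , record { down = λ _ → id ; up = λ _ → id }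
  uncons (infinite f es) refl max _ =
    f 1 , infinite (f ∘ suc) (es ∘ suc) , es 0 , refl , _ , record { down = λ _ → id ; up = λ _ → id }

  cons : ∀ π {x y} → π [ 0 ]= y → Maximal π → x ⟶ y →
         ∃[ π′ ] (π′ [ 0 ]= x × Maximal π′ × π IsTailOf π′)
  cons (finite y ys l) {x} refl max e =
    finite x (y ∷ ys) (e ∷ l) , refl , max , record { down = λ _ → id ; up = λ _ → id }
  cons (infinite f es) {x} refl _ e =
    infinite g (λ { zero → e ; (suc i) → es i }) , refl , _ , record { down = λ _ → id ; up = λ _ → id }
    where
    g : ℕ → Node
    g zero    = x
    g (suc i) = f i

  -- Each `step` peels one node off the path; the successor it supplies prevents a maximal path from
  -- ending there.
  until⇒precedes : ∀ {D c x} → ¬ D c → Until _⟶_ D c x → AllMaximalPathsFrom x (Precedes D c)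
  until⇒precedes {D} {c} c∉D here π π₀ max = 0 , π₀ , positive
    where
    positive : ∀ j {n} → π [ j ]= n → D n → 0 < j
    positive zero    πⱼ n∈D = contradiction (subst D ([0]-unique π πⱼ π₀) n∈D) c∉D
    positive (suc j) _  _   = s≤s z≤n
  until⇒precedes {D} {c} c∉D (step {x} x∉D next u) π π₀ max
    with y , π′ , e , π′₀ , max′ , t ← uncons π π₀ max next
    with i , π′ᵢ , first ← until⇒precedes c∉D (u e) π′ π′₀ max′
    = suc i , up i π′ᵢ , later
    where
    open _IsTailOf_ t
    later : ∀ j {n} → π [ j ]= n → D n → suc i < j
    later zero    πⱼ n∈D = contradiction (subst D ([0]-unique π πⱼ π₀) n∈D) x∉D
    later (suc j) πⱼ n∈D = s≤s (first j (down j πⱼ) n∈D)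

  module _ {S : Pred Node 0ℓ} (S? : Decidable S)
           (progress : ∀ {x} → S x → Sink x ⊎ ∃[ y ] (x ⟶ y × S y)) where

    MaximalPathWithin : Pred Node 0ℓ
    MaximalPathWithin x = ∃[ π ] (π [ 0 ]= x × Maximal π × (∀ i {n} → π [ i ]= n → S n))

    finitePath : Reach _⟶_ S (S ∩ Sink) ⊆ MaximalPathWithin
    finitePath (stop (s , end)) =
      finite _ [] [-] , refl , (λ { _ refl → end }) , λ { zero refl → s ; (suc zero) () ; (suc (suc _)) () }
    finitePath {x} (step s e r)
      with π , π₀ , max , within ← finitePath r
      with π′ , π′₀ , max′ , t ← cons π π₀ max e
      = π′ , π′₀ , max′ , within′
      where
      within′ : ∀ i {n} → π′ [ i ]= n → S n
      within′ zero    eq = subst S ([0]-unique π′ π′₀ eq) s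
      within′ (suc i) eq = within i (_IsTailOf_.down t i eq)

    -- If a sink can be reached inside `S`, the path to it is maximal. Otherwise `progress` never
    -- yields a sink, and iterating it gives an infinite path.
    maximalPath : S ⊆ MaximalPathWithin
    maximalPath {x} s with reach? _⟶?_ S? (S? ∩? sink?) x
    ... | yes r = finitePath r
    ... | no ¬r = infinite (proj₁ ∘ walk) (λ i → proj₁ (proj₂ (next (walk i))))
                , refl , _ , λ { i refl → proj₁ (proj₂ (walk i)) }
      where
      Endless : Set
      Endless = ∃[ y ] (S y × ¬ Reach _⟶_ S (S ∩ Sink) y)
      next : ((y , _) : Endless) → ∃[ z ] (y ⟶ z × S z × ¬ Reach _⟶_ S (S ∩ Sink) z)
      next (y , s , ¬r) with progress s
      ... | inj₁ end         = contradiction (stop (s , end)) ¬r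
      ... | inj₂ (z , e , t) = z , e , t , ¬r ∘ step s e
      walk : ℕ → Endless
      walk zero    = x , s , ¬r
      walk (suc i) = let z , _ , t = next (walk i) in z , t

  -- Decidability of `Until` turns a failing universal premise of `step` into a successor at which
  -- `Until` fails too.
  ¬until-step : ∀ {D c x} → Decidable D → ¬ Until _⟶_ D c x →
                D x ⊎ Sink x ⊎ ∃[ y ] (x ⟶ y × ¬ Until _⟶_ D c y)
  ¬until-step {D} {c} {x} D? ¬u with D? x | sinkOrSuccessor x | any? (λ y → (x ⟶? y) ×-dec ¬? (until? _⟶?_ D? c y))
  ... | yes d | _        | _     = inj₁ d
  ... | no _  | inj₁ end | _     = inj₂ (inj₁ end)
  ... | no _  | inj₂ _   | yes e = inj₂ (inj₂ e)
  ... | no ¬d | inj₂ e   | no ¬e = contradiction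
    (step ¬d e λ {y} x⟶y → decidable-stable (until? _⟶?_ D? c y) (λ ¬uy → ¬e (y , x⟶y , ¬uy))) ¬u

  -- Unless c is forced, some maximal path either avoids c altogether or avoids it
  -- up to a node of D and continues arbitrarily from there.
  precedes⇒until : ∀ {D c x} → Decidable D → AllMaximalPathsFrom x (Precedes D c) → Until _⟶_ D c x
  precedes⇒until {D} {c} {x} D? all = decidable-stable (until? _⟶?_ D? c x) λ ¬u →
    let π , π₀ , max , bad = badPath ¬u in bad (all π π₀ max)
    where
    Free : Pred Node 0ℓ
    Free = ∁ (Until _⟶_ D c)

    Free? : Decidable Free
    Free? = ∁? (until? _⟶?_ D? c)

    BadPath : Pred Node 0ℓ
    BadPath y = ∃[ π ] (π [ 0 ]= y × Maximal π × ¬ Precedes D c π)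

    viaD : Reach _⟶_ Free (Free ∩ D) ⊆ BadPath
    viaD {y} (stop (_ , d))
      with π , π₀ , max , _ ← maximalPath {S = U} U? (λ {z} _ → Sum.map₂ (map₂ (_, _)) (sinkOrSuccessor z)) {y} _
      = π , π₀ , max , λ (i , _ , first) → contradiction (first 0 π₀ d) λ ()
    viaD (step ¬u e r)
      with π , π₀ , max , bad ← viaD r
      with π′ , π′₀ , max′ , t ← cons π π₀ max e
      = π′ , π′₀ , max′ , bad′
      where
      open _IsTailOf_ t
      bad′ : ¬ Precedes D c π′
      -- The new starting node cannot be `c`, since `here` would then force it.
      bad′ (zero  , c₀ , _) with refl ← [0]-unique π′ π′₀ c₀ = ¬u here
      bad′ (suc i , cᵢ , first) = bad (i , down i cᵢ , λ j πⱼ d → s<s⁻¹ (first (suc j) (up j πⱼ) d))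

    badPath : Free ⊆ BadPath
    badPath {y} ¬u with reach? _⟶?_ Free? (Free? ∩? D?) y
    ... | yes r = viaD r
    ... | no ¬r =
      let π , π₀ , max , within = maximalPath
            (Free? ∩? ∁? (reach? _⟶?_ Free? (Free? ∩? D?))) progress (¬u , ¬r)
      in π , π₀ , max , λ (i , πᵢ , _) → proj₁ (within i πᵢ) here
      where
      progress : ∀ {z} → (Free ∩ ∁ (Reach _⟶_ Free (Free ∩ D))) z →
                 Sink z ⊎ ∃[ w ] (z ⟶ w × (Free ∩ ∁ (Reach _⟶_ Free (Free ∩ D))) w)
      progress (¬u , ¬r) with ¬until-step D? ¬u
      ... | inj₁ d                     = contradiction (stop (¬u , d)) ¬r
      ... | inj₂ (inj₁ end)            = inj₁ end
      ... | inj₂ (inj₂ (w , e , ¬u′)) = inj₂ (w , e , ¬u′ , ¬r ∘ step ¬u e)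

  contains⇒until : ∀ {c x} → AllMaximalPathsFrom x (Contains c) → Until _⟶_ ∅ c x
  contains⇒until {c} all = precedes⇒until ∅? onEach
    where
    onEach : AllMaximalPathsFrom _ (Precedes ∅ c)
    onEach π π₀ max with i , πᵢ ← all π π₀ max = i , πᵢ , λ _ _ ()

  until⇒contains : ∀ {c x} → Until _⟶_ ∅ c x → AllMaximalPathsFrom x (Contains c)
  until⇒contains u π π₀ max with i , πᵢ , _ ← until⇒precedes (λ ()) u π π₀ max = i , πᵢ

  before⇒until : ∀ {a b x} → AllMaximalPathsFrom x (ContainsBeforeAny a b) → Until _⟶_ (_≡ b) a x
  before⇒until {a} {b} all = precedes⇒until (_≟ b) onEach
    where
    onEach : AllMaximalPathsFrom _ (Precedes (_≡ b) a)
    onEach π π₀ max with i , πᵢ , first ← all π π₀ max = i , πᵢ , λ { j πⱼ refl → first j πⱼ }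

  until⇒before : ∀ {a b x} → a ≢ b → Until _⟶_ (_≡ b) a x → AllMaximalPathsFrom x (ContainsBeforeAny a b)
  until⇒before a≢b u π π₀ max with i , πᵢ , first ← until⇒precedes a≢b u π π₀ max =
    i , πᵢ , λ j πⱼ → first j πⱼ refl

-- Walks and ways to cut them.

module _ {n : ℕ} (_~>_ : Rel (Fin n) 0ℓ) where

  -- A walk from z to t; every node except possibly z itself lies outside D.
  data Walk (D : Pred (Fin n) 0ℓ) : Rel (Fin n) 0ℓ where
    []  : ∀ {z} → Walk D z z
    _∷_ : ∀ {z z′ t} → z ~> z′ × ¬ D z′ → Walk D z′ t → Walk D z t

  DeadEnd : Pred (Fin n) 0ℓ
  DeadEnd z = ∀ z′ → ¬ (z ~> z′)

  Continues : Pred (Fin n) 0ℓ → Pred (Fin n) 0ℓ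
  Continues S z = ∃[ z′ ] (z ~> z′ × S z′) ⊎ DeadEnd z

module _ {n : ℕ} {_~>_ : Rel (Fin n) 0ℓ} where

  weaken : ∀ {D D′ z t} → D′ ⊆ D → Walk _~>_ D z t → Walk _~>_ D′ z t
  weaken D′⊆D []             = []
  weaken D′⊆D ((e , ¬d) ∷ w) = (e , ¬d ∘ D′⊆D) ∷ weaken D′⊆D w

  _▷_ : ∀ {D s z t} → Walk _~>_ D s z → Walk _~>_ D z t → Walk _~>_ D s t
  []       ▷ w′ = w′
  (e ∷ w) ▷ w′ = e ∷ (w ▷ w′)

  lastVisit : ∀ {D z t} → Decidable D → Walk _~>_ ∅ z t →
              Walk _~>_ D z t ⊎ ∃[ d ] (D d × Walk _~>_ D d t)
  lastVisit D? [] = inj₁ []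
  lastVisit D? (_∷_ {z′ = z′} (e , _) w) with lastVisit D? w | D? z′
  ... | inj₂ v | _      = inj₂ v
  ... | inj₁ v | yes d  = inj₂ (z′ , d , v)
  ... | inj₁ v | no ¬d  = inj₁ ((e , ¬d) ∷ v)

  firstVisit : ∀ {D z t} → Decidable D → ¬ D z → D t → Walk _~>_ ∅ z t →
               ∃[ m ] ∃[ d ] (Walk _~>_ D z m × m ~> d × D d)
  firstVisit D? ¬dz dt [] = contradiction dt ¬dz
  firstVisit D? ¬dz dt (_∷_ {z′ = z′} (e , _) w) with D? z′
  ... | yes d  = _ , z′ , [] , e , d
  ... | no ¬d with m , d , v , e′ , Dd ← firstVisit D? ¬d dt w = m , d , (e , ¬d) ∷ v , e′ , Dd

  -- The walk is cut where it first meets `u` or `u′`.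
  firstOfTwo : ∀ {z u u′} → u ≢ u′ → Walk _~>_ ∅ z u →
               (z ≢ u′ × Walk _~>_ (_≡ u′) z u) ⊎ (z ≢ u × Walk _~>_ (_≡ u) z u′)
  firstOfTwo u≢u′ [] = inj₁ (u≢u′ , [])
  firstOfTwo {z} {u} {u′} u≢u′ ((e , _) ∷ w) with z ≟ u | z ≟ u′
  ... | yes refl | _        = inj₁ (u≢u′ , [])
  ... | no z≢u   | yes refl = inj₂ (z≢u , [])
  ... | no z≢u   | no z≢u′ with firstOfTwo u≢u′ w
  ...   | inj₁ (z′≢u′ , v) = inj₁ (z≢u′ , (e , z′≢u′) ∷ v)
  ...   | inj₂ (z′≢u , v)  = inj₂ (z≢u , (e , z′≢u) ∷ v)

  walk? : B.Decidable _~>_ → ∀ t → Decidable (λ z → Walk _~>_ ∅ z t)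
  walk? _~>?_ t z = map′ to from (reach? _~>?_ {S = U} U? (_≟ t) z)
    where
    to : ∀ {z} → Reach _~>_ U (_≡ t) z → Walk _~>_ ∅ z t
    to (stop refl)  = []
    to (step _ e r) = (e , λ ()) ∷ to r
    from : ∀ {z} → Walk _~>_ ∅ z t → Reach _~>_ U (_≡ t) z
    from []            = stop refl
    from ((e , _) ∷ w) = step _ e (from w)

  until⇒walk : ∀ {D a z} → Until _~>_ D a z → Walk _~>_ ∅ z a
  until⇒walk here               = []
  until⇒walk (step _ (_ , e) f) = (e , λ ()) ∷ until⇒walk (f e)

  -- Followed along a walk that avoids `a`, the derivation never meets `here`; it arrives at `b`
  -- with a `step`, which forbids `b`.
  until⇒¬walk : ∀ {a b z} → Until _~>_ (_≡ b) a z → z ≢ a → ¬ Walk _~>_ (_≡ a) z b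
  until⇒¬walk here         a≢a _              = a≢a refl
  until⇒¬walk (step b≢b _ _) _ []             = b≢b refl
  until⇒¬walk (step _ _ f) _ ((e , z′≢a) ∷ w) = until⇒¬walk (f e) z′≢a w

  module _ {D : Pred (Fin n) 0ℓ} where

    after : ∀ {z t} → Walk _~>_ D z t → List (Fin n)
    after []                = []
    after (_∷_ {z′ = z′} _ w) = z′ ∷ after w

    after-linked : ∀ {z t} (w : Walk _~>_ D z t) → Linked _~>_ (z ∷ after w)
    after-linked []            = [-]
    after-linked ((e , _) ∷ w) = e ∷ after-linked w

    after-all : ∀ {P : Pred (Fin n) 0ℓ} → (∀ {u v} → u ~> v → P v) →
                ∀ {z t} (w : Walk _~>_ D z t) → All (P ∖ D) (after w)
    after-all f []             = []
    after-all f ((e , ¬d) ∷ w) = (f e , ¬d) ∷ after-all f w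

    after-last : ∀ {z t} (w : Walk _~>_ D z t) → last (z ∷ after w) ≡ just t
    after-last []      = refl
    after-last (_ ∷ w) = after-last w

    steps : ∀ {z t} → Walk _~>_ D z t → ℕ
    steps []      = 0
    steps (_ ∷ w) = suc (steps w)

    steps-positive : ∀ {z t} → z ≢ t → (w : Walk _~>_ D z t) → 0 < steps w
    steps-positive z≢z []      = contradiction refl z≢z
    steps-positive _   (_ ∷ w) = s≤s z≤n

    nodeAt-▷ : ∀ {s z t} (v : Walk _~>_ D s z) (w : Walk _~>_ D z t) k →
               nodeAt (s ∷ after (v ▷ w)) (steps v + k) ≡ nodeAt (z ∷ after w) k
    nodeAt-▷ []      w k = refl
    nodeAt-▷ (_ ∷ v) w k = nodeAt-▷ v w k

-- Positions and links in lists.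

module _ {A : Set} where

  All-nodeAt : ∀ {P : Pred A 0ℓ} {xs} → All P xs → ∀ k {z} → nodeAt xs k ≡ just z → P z
  All-nodeAt []       zero    ()
  All-nodeAt []       (suc k) ()
  All-nodeAt (p ∷ ps) zero    refl = p
  All-nodeAt (p ∷ ps) (suc k) eq   = All-nodeAt ps k eq

  Linked-nodeAt : ∀ {R : Rel A 0ℓ} {xs} → Linked R xs → ∀ k {z} → nodeAt xs (suc k) ≡ just z →
                  ∃[ u ] (nodeAt xs k ≡ just u × R u z)
  Linked-nodeAt []      k       ()
  Linked-nodeAt [-]     zero    ()
  Linked-nodeAt [-]     (suc k) ()
  Linked-nodeAt (r ∷ _) zero    refl = _ , refl , r
  Linked-nodeAt (_ ∷ l) (suc k) eq   = Linked-nodeAt l k eq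

  Linked-∷⁻ : ∀ {R : Rel A 0ℓ} {x n} ms → Linked R (x ∷ (ms ∷ʳ n)) →
              ∃[ y ] (head (ms ∷ʳ n) ≡ just y × R x y × Linked R (ms ∷ʳ n))
  Linked-∷⁻ []      (r ∷ l) = _ , refl , r , l
  Linked-∷⁻ (_ ∷ _) (r ∷ l) = _ , refl , r , l

  Linked-∷⁺ : ∀ {R : Rel A 0ℓ} {x y n} ms → head (ms ∷ʳ n) ≡ just y → R x y →
              Linked R (ms ∷ʳ n) → Linked R (x ∷ (ms ∷ʳ n))
  Linked-∷⁺ []      refl r l = r ∷ l
  Linked-∷⁺ (_ ∷ _) refl r l = r ∷ l

-- The simple cycle outside `p`, in an abstract graph.

module Cycle {n : ℕ} (_~>_ : Rel (Fin n) 0ℓ) (_~>?_ : B.Decidable _~>_)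
  (V : Pred (Fin n) 0ℓ) (sourceInV : ∀ {x y} → x ~> y → V x) (targetInV : ∀ {x y} → x ~> y → V y)
  (p : Fin n)
  (unavoidable : ∀ {S : Pred (Fin n) 0ℓ} → S p → S ⊆ Continues _~>_ S → ∀ {c} → V c → ¬ ¬ S c)
  {x y : Fin n} (x≢y : x ≢ y) (p~>x : p ~> x) (p~>y : p ~> y) where

  -- With a loop at `p`, the singleton of `p` would progress forever and so contain both `x` and
  -- `y`.
  p≁>p : ¬ (p ~> p)
  p≁>p p~>p = only p~>x λ x≡p → only p~>y λ y≡p → x≢y (trans x≡p (sym y≡p))
    where
    only : ∀ {w} → p ~> w → ¬ ¬ (w ≡ p)
    only e = unavoidable {S = _≡ p} refl (λ { refl → inj₁ (p , p~>p , refl) }) (targetInV e)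

  successor≢p : ∀ {w} → p ~> w → w ≢ p
  successor≢p e refl = p≁>p e

  -- Progress may lead back to `p`, from where a successor of `p` in `S` resumes it.
  orP : Pred (Fin n) 0ℓ → Pred (Fin n) 0ℓ
  orP S = S ∪ (_≡ p)

  unavoidableFromP : ∀ {S w c} → S ⊆ Continues _~>_ (orP S) → p ~> w → S w → V c → c ≢ p → ¬ ¬ S c
  unavoidableFromP {S} progress e s c∈V c≢p c∉S =
    unavoidable {S = orP S} (inj₂ refl)
      (λ { (inj₁ s′) → progress s′ ; (inj₂ refl) → inj₁ (_ , e , inj₁ s) })
      c∈V [ c∉S , c≢p ]′

  -- The nodes reachable from `w` progress: each is a dead end or has a successor, again reachable.
  walkFromP : ∀ {w c} → p ~> w → V c → c ≢ p → Walk _~>_ ∅ w c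
  walkFromP {w} {c} e c∈V c≢p = decidable-stable (walk? _~>?_ c w)
    (unavoidableFromP {S = Walk _~>_ ∅ w} progress e [] c∈V c≢p)
    where
    progress : Walk _~>_ ∅ w ⊆ Continues _~>_ (orP (Walk _~>_ ∅ w))
    progress {z} v with any? (z ~>?_)
    ... | yes (z′ , e) = inj₁ (z′ , e , inj₁ (v ▷ ((e , λ ()) ∷ [])))
    ... | no dead      = inj₂ λ z′ e → dead (z′ , e)

  module _ {S : Pred (Fin n) 0ℓ} (progress : S ⊆ Continues _~>_ (orP S))
           {u} (u∈S : S u) (u∈V : V u) (u≢p : u ≢ p) where

    -- A walk to S avoiding c would extend to one from p that misses c.
    joinable : ∀ {w c} → p ~> w → w ≢ c → Walk _~>_ (_≡ c) w u → V c → c ≢ p → ¬ ¬ S c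
    joinable {w} {c} e w≢c v c∈V c≢p c∉S =
      unavoidableFromP {S = S ∪ T} progress′ e (inj₂ (w≢c , v)) c∈V c≢p
        [ c∉S , (λ (c≢c , _) → c≢c refl) ]′
      where
      T : Pred (Fin n) 0ℓ
      T z = z ≢ c × Walk _~>_ (_≡ c) z u
      widen : ∀ {z} → orP S z → orP (S ∪ T) z
      widen = Sum.map₁ inj₁
      lift : ∀ {z} → Continues _~>_ (orP S) z → Continues _~>_ (orP (S ∪ T)) z
      lift = Sum.map₁ (map₂ (map₂ widen))
      progress′ : S ∪ T ⊆ Continues _~>_ (orP (S ∪ T))
      progress′ (inj₁ s)                  = lift (progress s)
      progress′ (inj₂ (_ , []))           = lift (progress u∈S)
      progress′ (inj₂ (_ , (e , ne) ∷ v)) = inj₁ (_ , e , inj₁ (inj₂ (ne , v)))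

    -- A walk from `x` to `u` is cut at its last visit to `x` or `y`. If that is `y`, the rest
    -- avoids `x`, and `joinable` puts `x` in `S`. If it is `x`, the rest avoids `y`, so `y` is in
    -- `S`, and progress from `p` through `y` forces `x` into `S`.
    containsSuccessor : ¬ ¬ S x
    containsSuccessor x∉S = throughY λ y∈S →
      unavoidableFromP progress p~>y y∈S (targetInV p~>x) (successor≢p p~>x) x∉S
      where
      fromX : Walk _~>_ (λ z → z ≡ x ⊎ z ≡ y) x u → ¬ ¬ S y
      fromX v = joinable p~>x x≢y (weaken inj₂ v) (targetInV p~>y) (successor≢p p~>y)
      throughY : ¬ ¬ S y
      throughY y∉S with lastVisit (λ z → (z ≟ x) ⊎-dec (z ≟ y)) (walkFromP p~>x u∈V u≢p)
      ... | inj₁ v                    = fromX v y∉S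
      ... | inj₂ (_ , inj₁ refl , v) = fromX v y∉S
      ... | inj₂ (_ , inj₂ refl , v) =
        joinable p~>y (≢-sym x≢y) (weaken inj₁ v) (targetInV p~>x) (successor≢p p~>x) x∉S

    containsAll : ∀ {c} → V c → c ≢ p → ¬ ¬ S c
    containsAll c∈V c≢p c∉S =
      containsSuccessor λ x∈S → unavoidableFromP progress p~>x x∈S c∈V c≢p c∉S

  -- Otherwise the singleton of `u` would contain both `x` and `y`. This rules out loops, edges back
  -- to `p` and dead ends alike.
  noSingleton : ∀ {u} → V u → u ≢ p → ¬ Continues _~>_ (orP (_≡ u)) u
  noSingleton {u} u∈V u≢p progress = all p~>x λ x≡u → all p~>y λ y≡u → x≢y (trans x≡u (sym y≡u))
    where
    all : ∀ {w} → p ~> w → ¬ ¬ (w ≡ u)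
    all e = containsAll {S = _≡ u} (λ { refl → progress }) refl u∈V u≢p (targetInV e) (successor≢p e)

  ≁>p : ∀ {u} → ¬ (u ~> p)
  ≁>p {u} e with u ≟ p
  ... | yes refl = p≁>p e
  ... | no u≢p   = noSingleton (sourceInV e) u≢p (inj₁ (p , e , inj₂ refl))

  successorExists : ∀ {u} → V u → ∃ (u ~>_)
  successorExists {u} u∈V with u ≟ p | any? (u ~>?_)
  ... | _        | yes next = next
  ... | yes refl | no _     = x , p~>x
  ... | no u≢p   | no dead  = contradiction (inj₂ λ z e → dead (z , e)) (noSingleton u∈V u≢p)

  -- The nodes of `V` reachable from `u` progress, hence exhaust `V` apart from `p`.
  walkTo : ∀ {u c} → V u → u ≢ p → V c → c ≢ p → Walk _~>_ ∅ u c
  walkTo {u} {c} u∈V u≢p c∈V c≢p = decidable-stable (walk? _~>?_ c u)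
    (containsAll {S = λ z → V z × Walk _~>_ ∅ u z} progress (u∈V , []) u∈V u≢p c∈V c≢p ∘ (_∘ proj₂))
    where
    progress : (λ z → V z × Walk _~>_ ∅ u z) ⊆ Continues _~>_ (orP (λ z → V z × Walk _~>_ ∅ u z))
    progress (z∈V , v) with z′ , e ← successorExists z∈V =
      inj₁ (z′ , e , inj₁ (targetInV e , v ▷ ((e , λ ()) ∷ [])))

  -- Closing up a walk from a successor of u to u gives a set that walks on forever.
  noShortcut : ∀ {u z c} → u ~> z → u ≢ p → u ≢ c → z ≢ c → V c → c ≢ p → ¬ Walk _~>_ (_≡ c) z u
  noShortcut {u} {z} {c} e u≢p u≢c z≢c c∈V c≢p v =
    containsAll {S = S} progress (u≢c , []) (sourceInV e) u≢p c∈V c≢p (λ (c≢c , _) → c≢c refl)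
    where
    S : Pred (Fin n) 0ℓ
    S w = w ≢ c × Walk _~>_ (_≡ c) w u
    progress : S ⊆ Continues _~>_ (orP S)
    progress (_ , [])            = inj₁ (z , e , inj₁ (z≢c , v))
    progress (_ , (e′ , ne) ∷ w) = inj₁ (_ , e′ , inj₁ (ne , w))

  -- A walk from `z` reaches one of two distinct predecessors first, and the edge from that one to
  -- `z` closes a cycle that avoids the other.
  predecessorUnique : ∀ {u u′ z} → u ~> z → u′ ~> z → u ≢ p → u′ ≢ p → u ≡ u′
  predecessorUnique {u} {u′} {z} e e′ u≢p u′≢p = decidable-stable (u ≟ u′) distinct
    where
    distinct : ¬ (u ≢ u′)
    distinct u≢u′ with firstOfTwo u≢u′ (walkTo (targetInV e) (λ { refl → ≁>p e }) (sourceInV e) u≢p)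
    ... | inj₁ (z≢u′ , v) = noShortcut e u≢p u≢u′ z≢u′ (sourceInV e′) u′≢p v
    ... | inj₂ (z≢u , v)  = noShortcut e′ u′≢p (≢-sym u≢u′) z≢u (sourceInV e) u≢p v

  -- On a walk from `z` back to `u`, the part after the last visit to `z` or `z′` avoids one of the
  -- two; the edge from `u` to the other closes it to a cycle.
  successorUnique : ∀ {u z z′} → u ≢ p → u ~> z → u ~> z′ → z ≡ z′
  successorUnique {u} {z} {z′} u≢p e e′ = decidable-stable (z ≟ z′) distinct
    where
    noLoop : ¬ (u ~> u)
    noLoop l = noSingleton (sourceInV e) u≢p (inj₁ (u , l , inj₁ refl))
    fromOne : ∀ {w w′} → u ~> w → u ~> w′ → w ≢ w′ → ¬ Walk _~>_ (_≡ w′) w u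
    fromOne f f′ w≢w′ =
      noShortcut f u≢p (λ { refl → noLoop f′ }) w≢w′ (targetInV f′) (λ { refl → ≁>p f′ })
    distinct : ¬ (z ≢ z′)
    distinct z≢z′ with lastVisit (λ w → (w ≟ z) ⊎-dec (w ≟ z′))
                        (walkTo (targetInV e) (λ { refl → ≁>p e }) (sourceInV e) u≢p)
    ... | inj₁ v                   = fromOne e e′ z≢z′ (weaken inj₂ v)
    ... | inj₂ (_ , inj₁ refl , v) = fromOne e e′ z≢z′ (weaken inj₂ v)
    ... | inj₂ (_ , inj₂ refl , v) = fromOne e′ e (≢-sym z≢z′) (weaken inj₁ v)

-- The graph of intervals between nodes of `V[ p ]`.

module _ (G : CFG) (p : Graph.Node G) where
  open CFG G
  open Graph G

  private
    V : Pred Node 0ℓ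
    V = V[ p ]

    _⟶ᴬ_ : Rel Node 0ℓ
    _⟶ᴬ_ = A[ p ]

    edge? : B.Decidable _⟶_
    edge? = _⟶?_ G

  opaque
    V? : Decidable V
    V? c = map′ (until⇒contains G) (contains⇒until G) (until? edge? ∅? c p)

  -- `Entry` with the arguments swapped and the list of nodes replaced by a derivation, which is
  -- decidable and can be followed alongside `Until`.
  Hits : Node → Pred Node 0ℓ
  Hits n = Reach _⟶_ (∁ V) (λ z → z ≡ n × V z)

  entry⇒hits : ∀ {s n} → Entry p s n → Hits n s
  entry⇒hits {n = n} (n∈V , ms , ms∉V , hd , l) = follow ms ms∉V hd l
    where
    follow : ∀ {s} ms → All (∁ V) ms → head (ms ∷ʳ n) ≡ just s → Linked _⟶_ (ms ∷ʳ n) → Hits n s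
    follow []       []           refl _ = stop (refl , n∈V)
    follow (_ ∷ ms) (m∉V ∷ ms∉V) refl l
      with _ , hd , e , l′ ← Linked-∷⁻ ms l = step m∉V e (follow ms ms∉V hd l′)

  entry-here : ∀ {n} → V n → Entry p n n
  entry-here n∈V = n∈V , [] , [] , refl , [-]

  entry-step : ∀ {y y′ n} → ¬ V y → y ⟶ y′ → Entry p y′ n → Entry p y n
  entry-step y∉V e (n∈V , ms , ms∉V , hd , l) =
    n∈V , _ ∷ ms , y∉V ∷ ms∉V , refl , Linked-∷⁺ ms hd e l

  hits⇒entry : ∀ {s n} → Hits n s → Entry p s n
  hits⇒entry (stop (refl , n∈V)) = entry-here n∈V
  hits⇒entry (step y∉V e h)      = entry-step y∉V e (hits⇒entry h)

  opaque
    entry? : ∀ s → Decidable (Entry p s)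
    entry? s n = map′ hits⇒entry entry⇒hits (reach? edge? (∁? V?) (λ z → (z ≟ n) ×-dec V? z) s)

  edge⁺ : ∀ {x x′ y} → V x → x ⟶ x′ → Entry p x′ y → x ⟶ᴬ y
  edge⁺ x∈V e (y∈V , ms , ms∉V , hd , l) = x∈V , y∈V , ms , ms∉V , Linked-∷⁺ ms hd e l

  edge⁻ : ∀ {x y} → x ⟶ᴬ y → ∃[ x′ ] (x ⟶ x′ × Entry p x′ y)
  edge⁻ (_ , y∈V , ms , ms∉V , l) with x′ , hd , e , l′ ← Linked-∷⁻ ms l =
    x′ , e , y∈V , ms , ms∉V , hd , l′

  _⟶ᴬ?_ : B.Decidable _⟶ᴬ_
  x ⟶ᴬ? y = map′ (λ (x∈V , _ , e , ent) → edge⁺ x∈V e ent)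
                 (λ e → let x′ , e′ , ent = edge⁻ e in proj₁ e , x′ , e′ , ent)
                 (V? x ×-dec any? (λ x′ → edge? x x′ ×-dec entry? x′ y))

  p∈V : V p
  p∈V = until⇒contains G here

  -- Outside V, follow edges to a node of S while possible; once V can no longer be
  -- reached, any continuation will do.
  unavoidable : ∀ {S : Pred Node 0ℓ} → S p → S ⊆ Continues _⟶ᴬ_ S → ∀ {c} → V c → ¬ ¬ S c
  unavoidable {S} p∈S progress {c} c∈V c∉S = avoids (contains⇒until G c∈V) (inj₁ (p∈V , p∈S))
    where
    ToS Lost : Pred Node 0ℓ
    ToS y  = ∃[ z ] (Entry p y z × S z)
    Lost y = ∀ {z} → ¬ Entry p y z

    onward : ∀ {y z} → Hits z y → S z → (V y × S y) ⊎ (¬ V y × ToS y)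
    onward (stop (refl , z∈V)) z∈S = inj₁ (z∈V , z∈S)
    onward h@(step y∉V _ _)    z∈S = inj₂ (y∉V , _ , hits⇒entry h , z∈S)

    -- The path is built along the derivation of `Until`, whose end at `c` is refuted in every
    -- state, as `c` lies in `V` but not in `S`.
    avoids : ∀ {y} → Until _⟶_ ∅ c y → ¬ ((V y × S y) ⊎ (¬ V y × (ToS y ⊎ Lost y)))
    avoids here (inj₁ (_ , c∈S)) = c∉S c∈S
    avoids here (inj₂ (c∉V , _)) = c∉V c∈V
    avoids (step _ (y′ , e) f) (inj₁ (y∈V , y∈S)) with progress y∈S
    ... | inj₁ (z , e′ , z∈S) with y″ , e″ , ent ← edge⁻ e′ =
      avoids (f e″) (Sum.map₂ (map₂ inj₁) (onward (entry⇒hits ent) z∈S))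
    -- Reaching `V` again from `y` would give an edge out of a dead end, so any successor is lost.
    ... | inj₂ dead = avoids (f e)
      (inj₂ ((λ y′∈V → dead y′ (edge⁺ y∈V e (entry-here y′∈V))) , inj₂ λ ent → dead _ (edge⁺ y∈V e ent)))
    avoids (step _ _ f) (inj₂ (y∉V , inj₁ (z , ent , z∈S))) with entry⇒hits ent
    ... | stop (refl , z∈V) = y∉V z∈V
    ... | step _ e h        = avoids (f e) (Sum.map₂ (map₂ inj₁) (onward h z∈S))
    avoids (step _ (y′ , e) f) (inj₂ (y∉V , inj₂ lost)) = avoids (f e)
      (inj₂ ((λ y′∈V → lost (entry-step y∉V e (entry-here y′∈V))) , inj₂ λ ent → lost (entry-step y∉V e ent)))

  module _ {D : Pred Node 0ℓ} {a : Node} (a∈V : V a) where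

    -- Following the successors supplied by `Until` meets `V` at `a` at the latest.
    entryExists : ∀ {y} → Until _⟶_ D a y → ∃ (Entry p y)
    entryExists here = a , entry-here a∈V
    entryExists {y} (step _ (y′ , e) f) with V? y
    ... | yes y∈V = y , entry-here y∈V
    ... | no y∉V  = map₂ (entry-step y∉V e) (entryExists (f e))

    -- The path to `z` does not pass `a` before its end, since its earlier nodes lie outside `V`.
    until-entry : ∀ {y z} → Until _⟶_ D a y → Hits z y → Until _⟶_ D a z
    until-entry u            (stop (refl , _)) = u
    until-entry here         (step a∉V _ _)    = contradiction a∈V a∉V
    until-entry (step _ _ f) (step _ e h)      = until-entry (f e) h

    -- Interior nodes of an interval lie outside `V`, so they differ from `a`; their steps are
    -- consumed, and only steps at nodes of `V` are kept.
    untilᴬ : (∀ {u} → V u → ∃ (u ⟶ᴬ_)) → ∀ {y z} → Until _⟶_ D a y → Hits z y → Until _⟶ᴬ_ D a z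
    untilᴬ next here           (stop (refl , _))   = here
    untilᴬ next here           (step a∉V _ _)      = contradiction a∈V a∉V
    untilᴬ next (step d _ f)   (stop (refl , y∈V)) =
      step d (next y∈V) λ e → let _ , e′ , ent = edge⁻ e in untilᴬ next (f e′) (entry⇒hits ent)
    untilᴬ next (step _ _ f)   (step _ e h)        = untilᴬ next (f e) h

  -- Both derivations are followed along one path, where whichever of `a` and `b` comes first
  -- contradicts one of them.
  until-exclusive : ∀ {a b y} → a ≢ b → Until _⟶_ (_≡ b) a y → ¬ Until _⟶_ (_≡ a) b y
  until-exclusive a≢b here                 here           = a≢b refl
  until-exclusive a≢b here                 (step a≢a _ _) = a≢a refl
  until-exclusive a≢b (step b≢b _ _)       here           = b≢b refl
  until-exclusive a≢b (step _ (_ , e) f) (step _ _ g)   = until-exclusive a≢b (f e) (g e)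

  -- A common entry would force `a` before `b` and also `b` before `a`.
  differentEntries : ∀ {a b s₁ s₂} → V a → V b → a ≢ b → p ⟶ s₁ → p ⟶ s₂ →
    Until _⟶_ (_≡ b) a s₁ → Until _⟶_ (_≡ a) b s₂ → ∃[ x ] ∃[ y ] (x ≢ y × p ⟶ᴬ x × p ⟶ᴬ y)
  differentEntries a∈V b∈V a≢b e₁ e₂ u₁ u₂
    with x , ent₁ ← entryExists a∈V u₁ | y , ent₂ ← entryExists b∈V u₂ =
    x , y , differ , edge⁺ p∈V e₁ ent₁ , edge⁺ p∈V e₂ ent₂
    where
    differ : x ≢ y
    differ refl = until-exclusive a≢b (until-entry a∈V u₁ (entry⇒hits ent₁))
                                      (until-entry b∈V u₂ (entry⇒hits ent₂))

  -- Strips as segments of the cycle.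

  module _ {x y} (x≢y : x ≢ y) (p⟶x : p ⟶ᴬ x) (p⟶y : p ⟶ᴬ y)
           {s a b} (p⟶s : p ⟶ s) (p≢a : p ≢ a) (p≢b : p ≢ b) (a≢b : a ≢ b) where
    open Cycle _⟶ᴬ_ _⟶ᴬ?_ V proj₁ (proj₁ ∘ proj₂) p unavoidable x≢y p⟶x p⟶y

    private
      E : Pred Node 0ℓ
      E = Entry p s

    entry≢p : ∀ {n} → E n → n ≢ p
    entry≢p n∈E = successor≢p (edge⁺ p∈V p⟶s n∈E)

    endpoint≢p : ∀ {D z t} → Walk _⟶ᴬ_ D z t → z ≢ p → t ≢ p
    endpoint≢p []            z≢p = z≢p
    endpoint≢p ((e , _) ∷ w) _   = endpoint≢p w λ { refl → ≁>p e }

    walks⇒strip : ∀ {n m m′} → E n → Walk _⟶ᴬ_ E n a → Walk _⟶ᴬ_ E a b → Walk _⟶ᴬ_ E b m →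
                  m ⟶ᴬ m′ → E m′ → StripContainingBefore p s a b
    walks⇒strip {n} {m} {m′} n∈E v w u e m′∈E =
      n , after (v ▷ (w ▷ u))
      , record
        { path      = after-linked (v ▷ (w ▷ u))
        ; first     = n∈E
        ; others    = after-all (proj₁ ∘ proj₂) (v ▷ (w ▷ u))
        ; m         = m
        ; m′        = m′
        ; isLast    = after-last (v ▷ (w ▷ u))
        ; successor = e
        ; unique    = λ _ e′ → successorUnique (endpoint≢p u (≢-sym p≢b)) e′ e
        ; returns   = m′∈E
        }
      -- `a` stands where `v` ends and `b` where `w` ends; each final 0 is the position in the
      -- remaining walk to which `nodeAt-▷` reduces.
      , steps v + 0 , steps v + (steps w + 0)
      , nodeAt-▷ v (w ▷ u) 0
      , trans (nodeAt-▷ v (w ▷ u) _) (nodeAt-▷ w u 0)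
      , +-monoʳ-< (steps v) (≤-trans (steps-positive a≢b w) (m≤m+n _ 0))

    until⇒strip : V a → V b → Until _⟶_ (_≡ b) a s → StripContainingBefore p s a b
    until⇒strip a∈V b∈V u =
      assemble fromLastEntry toNextEntry
      where
      fromEntry : ∀ {e} → E e → Until _⟶ᴬ_ (_≡ b) a e
      fromEntry = untilᴬ a∈V successorExists u ∘ entry⇒hits
      fromLastEntry : ∃[ n ] (E n × Walk _⟶ᴬ_ E n a)
      fromLastEntry = let e , e∈E = entryExists a∈V u in
        [ (λ w → e , e∈E , w) , id ]′ (lastVisit (entry? s) (until⇒walk (fromEntry e∈E)))
      -- The walk to `b` is cut at its last visit to an entry or to `a`. Were this an entry other
      -- than `a`, the rest would reach `b` while avoiding `a`.
      E∪a : Pred Node 0ℓ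
      E∪a z = E z ⊎ z ≡ a
      avoidE : Walk _⟶ᴬ_ E∪a a b → Walk _⟶ᴬ_ E a b
      avoidE = weaken inj₁
      last⇒toB : ∀ {e} → Dec (e ≡ a) → E∪a e → Walk _⟶ᴬ_ E∪a e b → Walk _⟶ᴬ_ E a b
      last⇒toB (yes refl) _           w = avoidE w
      last⇒toB (no e≢a)   (inj₂ e≡a) w = contradiction e≡a e≢a
      last⇒toB (no e≢a)   (inj₁ e∈E) w =
        contradiction (weaken inj₂ w) (until⇒¬walk (fromEntry e∈E) e≢a)
      toB : Walk _⟶ᴬ_ E a b
      toB = [ avoidE , (λ (e , e∈E∪a , w) → last⇒toB (e ≟ a) e∈E∪a w) ]′
        (lastVisit (λ z → entry? s z ⊎-dec (z ≟ a)) (walkTo a∈V (≢-sym p≢a) b∈V (≢-sym p≢b)))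
      b∉E : ¬ E b
      b∉E b∈E = until⇒¬walk (fromEntry b∈E) (≢-sym a≢b) []
      toNextEntry : ∃[ m ] ∃[ m′ ] (Walk _⟶ᴬ_ E b m × m ⟶ᴬ m′ × E m′)
      toNextEntry with e , e∈E ← entryExists a∈V u =
        firstVisit (entry? s) b∉E e∈E (walkTo b∈V (≢-sym p≢b) (proj₁ e∈E) (entry≢p e∈E))

      assemble : ∃[ n ] (E n × Walk _⟶ᴬ_ E n a) → ∃[ m ] ∃[ m′ ] (Walk _⟶ᴬ_ E b m × m ⟶ᴬ m′ × E m′) →
                 StripContainingBefore p s a b
      assemble (_ , n∈E , v) (_ , _ , w , e , m′∈E) = walks⇒strip n∈E v toB w e m′∈E

    module _ {n ns} (strip : IsStrip p s n ns) {i j}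
             (aᵢ : nodeAt (n ∷ ns) i ≡ just a) (bⱼ : nodeAt (n ∷ ns) j ≡ just b) (i<j : i < j) where
      open IsStrip strip

      -- Every strip position after `i` counts, up to the end of the strip and not only up to `b`.
      Between : Pred Node 0ℓ
      Between z = ∃[ k ] (i < k × nodeAt (n ∷ ns) k ≡ just z)

      between⇒∉E : ∀ {z} → Between z → ¬ E z
      between⇒∉E (suc k , _ , zₖ) = proj₂ (All-nodeAt others k zₖ)

      onStrip≢p : ∀ k {z} → nodeAt (n ∷ ns) k ≡ just z → z ≢ p
      onStrip≢p zero    refl = entry≢p first
      onStrip≢p (suc k) zₖ refl with _ , _ , e ← Linked-nodeAt path k zₖ = ≁>p e

      -- The node before `z` on the strip is its only predecessor other than `p`; it stands at `i`,
      -- where `a` is, or later.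
      betweenBackwards : ∀ {u z} → u ⟶ᴬ z → u ≢ p → Between z → u ≡ a ⊎ Between u
      betweenBackwards {u} e u≢p (suc k , i<1+k , zₖ) =
        [ (λ i<k → inj₂ (k , i<k , uₖ))
        , (λ { refl → inj₁ (just-injective (trans (sym uₖ) aᵢ)) })
        ]′ (m≤n⇒m<n∨m≡n (s≤s⁻¹ i<1+k))
        where
        uₖ : nodeAt (n ∷ ns) k ≡ just u
        uₖ = let _ , u′ₖ , e′ = Linked-nodeAt path k zₖ in
          trans u′ₖ (cong just (predecessorUnique e′ e (onStrip≢p k u′ₖ) u≢p))

      -- Phrased through entries to cover nodes outside `V` as well; a node of `V` has only itself
      -- as entry.
      Safe : Pred Node 0ℓ
      Safe y = ∀ {z} → Entry p y z → ¬ Between z × z ≢ p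

      safe-step : ∀ {y y′} → y ≢ a → Safe y → y ⟶ y′ → Safe y′
      safe-step {y} y≢a safe e ent with V? y
      ... | no y∉V  = safe (entry-step y∉V e ent)
      ... | yes y∈V with y∉B , y≢p ← safe (entry-here y∈V) =
        (λ z∈B → [ y≢a , y∉B ]′ (betweenBackwards (edge⁺ y∈V e ent) y≢p z∈B)) ,
        λ { refl → ≁>p (edge⁺ y∈V e ent) }

      strip⊆V : ∀ k {z} → nodeAt (n ∷ ns) k ≡ just z → V z
      strip⊆V k = All-nodeAt (proj₁ first ∷ All.map proj₁ others) k

      -- Safety persists until `a` is met, and `b` is unsafe because it stands after `i` on the
      -- strip.
      aBeforeB : ∀ {y} → Until _⟶_ ∅ a y → Safe y → Until _⟶_ (_≡ b) a y
      aBeforeB here _ = here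
      aBeforeB {y} (step _ next f) safe with y ≟ a
      ... | yes refl = here
      ... | no y≢a   = step
        (λ { refl → proj₁ (safe (entry-here (strip⊆V j bⱼ))) (j , i<j , bⱼ) })
        next (λ e → aBeforeB (f e) (safe-step y≢a safe e))

      strip⇒until : Until _⟶_ (_≡ b) a s
      strip⇒until with contains⇒until G (strip⊆V i aᵢ)
      ... | here       = contradiction refl p≢a
      -- `s` is safe at the start: its entries are excluded from the strip after its first node, and
      -- none is `p`.
      ... | step _ _ f = aBeforeB (f p⟶s) λ ent → (λ z∈B → between⇒∉E z∈B ent) , entry≢p ent

theorem4p13 : (G : CFG) → let open Graph G in
    (p a b s₁ s₂ : Node) →
    p ≢ a → p ≢ b → a ≢ b →
    IsPredicateWithSuccessors p s₁ s₂ →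
    DOD p s₁ s₂ a b ⇔
    ((∃[ x ] ∃[ y ] (x ≢ y × A[ p ] p x × A[ p ] p y))
    × StripContainingBefore p s₁ a b
    × StripContainingBefore p s₂ b a)
theorem4p13 G p a b s₁ s₂ p≢a p≢b a≢b predicate = mk⇔ to from
  where
  open Graph G
  open IsPredicateWithSuccessors predicate
  b≢a = ≢-sym a≢b
  to : DOD p s₁ s₂ a b → _
  to dod
    with u₁ ← before⇒until G (DOD.fromS₁ dod) | u₂ ← before⇒until G (DOD.fromS₂ dod)
    with x , y , x≢y , e , e′ ← differentEntries G p (DOD.containsA dod) (DOD.containsB dod) a≢b edge₁ edge₂ u₁ u₂
    = (x , y , x≢y , e , e′)
    , until⇒strip G p x≢y e e′ edge₁ p≢a p≢b a≢b (DOD.containsA dod) (DOD.containsB dod) u₁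
    , until⇒strip G p x≢y e e′ edge₂ p≢b p≢a b≢a (DOD.containsB dod) (DOD.containsA dod) u₂
  from : _ → DOD p s₁ s₂ a b
  from ((x , y , x≢y , e , e′) , (_ , _ , strip₁ , i , j , aᵢ , bⱼ , i<j) , (_ , _ , strip₂ , k , l , bₖ , aₗ , k<l)) =
    record
    { containsA = strip⊆V G p x≢y e e′ edge₁ p≢a p≢b a≢b strip₁ aᵢ bⱼ i<j i aᵢ
    ; containsB = strip⊆V G p x≢y e e′ edge₁ p≢a p≢b a≢b strip₁ aᵢ bⱼ i<j j bⱼ
    ; fromS₁    = until⇒before G a≢b (strip⇒until G p x≢y e e′ edge₁ p≢a p≢b a≢b strip₁ aᵢ bⱼ i<j)
    ; fromS₂    = until⇒before G b≢a (strip⇒until G p x≢y e e′ edge₂ p≢b p≢a b≢a strip₂ bₖ aₗ k<l)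
    }
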